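{- Let $m\ge1$, $T\subseteq\{0,\ldots,m-1\}$, let $W\ge1$ be the machine-word width and $n=\lceil m/W\rceil$. Consider the packed scalar implementation of Frobenius-factorized reduction modulo $g=x^m+\sum_{t\in T}x^t\in\mathbb{F}_2[x]$ described in the context. For $U\ne0$, set $$a_k=\left\lceil\frac{m-2^k\Delta_{\min}}{W}\right\rceil\qquad(0\le k<r).$$ The useful feedback-word support and the shifted-word contributions traversed by the scalar stage loops are, respectively, $$\widehat B_{\mathrm{fb}}=\sum_{t\in T}\sum_{\substack{k\ge0\\2^k\Delta_t<m}}\left\lceil\frac{m-2^k\Delta_t}{W}\right\rceil,$$ $$B_{\mathrm{fb}}^{\mathrm{loop}}=\sum_{k=0}^{r-1}\sum_{t\in T_k}\min\left\{a_k,\,n-\left\lfloor\frac{2^k\Delta_t}{W}\right\rfloor\right\},$$ and the number of destination words touched by the low-assembly shifts is $$B_V=\sum_{t\in T}\left(n-\left\lfloor\frac{t}{W}\right\rfloor\right).$$ They satisfy $$\widehat B_{\mathrm{fb}}\le B_{\mathrm{fb}}^{\mathrm{loop}}\le\widehat B_{\mathrm{fb}}+S_{\mathrm{fb}}.$$ Moreover, $$\sum_{k=0}^{r-1}a_k\le B_{\mathrm{fb}}^{\mathrm{loop}}.$$ An in-place scalar implementation makes one $n$-word high-part extraction, traverses $a_k$ destination words at feedback stage $k$, and makes one $n$-word final assembly pass, in addition to the $B_{\mathrm{fb}}^{\mathrm{loop}}+B_V$ shifted contributions.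
   Context: For $t\in T$ put $\Delta_t=m-t$. For $d\ge 0$, $N^d$ is the truncated right shift on $\mathbb{F}_2^m$: $(N^dy)_i=y_{i+d}$ if $0\le i<m-d$ and $(N^dy)_i=0$ if $m-d\le i<m$; $N^d=0$ for $d\ge m$. Put $U=\sum_{t\in T}N^{\Delta_t}$ and $V(Y)=\sum_{t\in T}(x^tY\bmod x^m)$. When $U\neq0$, $\Delta_{\min}=\min\{\Delta_t:t\in T\}$ and $r=\lceil\log_2(m/\Delta_{\min})\rceil$. For $k\ge0$, $T_k=\{t\in T:2^k\Delta_t<m\}$, and $S_{\mathrm{fb}}=\sum_{k=0}^{r-1}|T_k|$. Frobenius-factorized reduction on input $A=L+x^mH$ ($\deg L,\deg H<m$): set $Y\leftarrow H$; for $k=0,\ldots,r-1$ replace $Y$ by $Y+\sum_{t\in T_k}N^{2^k\Delta_t}Y$ (all shifts reading the same stage input); return $L+V(Y)$ (final low-part assembly). Packed representation: a degree-below-$m$ polynomial is stored in $n$ words of $W$ bits, coefficient $i$ being bit $i\bmod W$ of word $\lfloor i/W\rfloor$, with zero padding above. Counts are of destination-word contributions (pairs of a shift and a destination word), not instructions. The useful feedback-word support counts, over all active pairs $(k,t)$ with shift $d=2^k\Delta_t<m$, the destination words meeting the coefficient positions $0,\ldots,m-d-1$ affected by that shift. The scalar loop of stage $k$ traverses the contiguous range of destination words, starting at word $0$, spanned by the union of all positions affected by active shifts of the stage; for each active shift $d=2^k\Delta_t$ it visits a destination word $w$ in this range only if the source-word index $w+\lfloor d/W\rfloor$ is below the end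 $n$ of the state. The low-assembly shift by $t$ affects the coefficient positions $t,\ldots,m-1$. -}

module Defs where

open import Data.Bool.Base using (Bool; true; false; _xor_; _∧_; if_then_else_)
open import Data.Bool.Properties using () renaming (_≟_ to _≟ᵇ_)
open import Data.Fin.Base using (Fin; toℕ; fromℕ<; _↑ˡ_; _↑ʳ_)
open import Data.Fin.Properties using (all?; any?; toℕ<n)
open import Data.Fin.Subset using (Subset; ⊤)
open import Data.Fin.Subset.Properties using (_∈?_)
open import Data.List.Base using (List; []; [_]; _∷_; _++_; map; filter; foldr; foldl; length; upTo; allFin; mapMaybe)
open import Data.List.Extrema.Nat using (min; v<min⁺)
open import Data.List.Relation.Unary.All using (universal)
open import Data.List.Relation.Unary.All.Properties using (map⁺)
open import Data.List.Relation.Unary.Any as Any using (Any)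
open import Data.Maybe.Base using (Maybe; just; nothing)
open import Data.Nat.Base using (ℕ; suc; _+_; _*_; _∸_; _^_; _⊓_; _≤_; _<_; _/_; _%_; NonZero; >-nonZero; >-nonZero⁻¹)
open import Data.Nat.ListAction using (sum)
open import Data.Nat.Logarithm using (⌈log₂_⌉)
open import Data.Nat.Properties using (_≟_; _≤?_; _<?_; m<n⇒0<n∸m)
open import Data.Product.Base using (∃; _×_; _,_; proj₁; proj₂)
open import Data.Vec.Base as Vec using (Vec)
open import Data.Vec.Functional using (Vector; zipWith; updateAt)
open import Function.Base using (const; _∘_)
open import Relation.Binary.PropositionalEquality using (_≡_; refl)
open import Relation.Nullary using (¬_; Dec; yes; no; does; _×-dec_)
open import Relation.Unary using (Decidable)

⌈_/_⌉ : (a b : ℕ) .{{_ : NonZero b}} → ℕ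
⌈ a / b ⌉ = (a + (b ∸ 1)) / b

∑ : {I : Set} → List I → (I → ℕ) → ℕ
∑ xs f = sum (map f xs)

infix 5 ∑
syntax ∑ xs (λ x → e) = ∑[ x ∈ xs ] e

count : {I : Set} {P : I → Set} → Decidable P → List I → ℕ
count P? xs = length (filter P? xs)

-- Reads entry i of a vector, the default z standing for entries past its end.
at : {A : Set} {l : ℕ} → A → Vector A l → ℕ → A
at {l = l} z v i with i <? l
... | yes i<l = v (fromℕ< i<l)
... | no  _   = z

-- 𝔽₂ is Bool with _xor_ as addition; a polynomial of degree below l is the
-- vector of its l coefficients.
⨁ : {I : Set} → List I → (I → Bool) → Bool
⨁ xs f = foldr _xor_ false (map f xs)

module Reduction (m W : ℕ) .{{m≢0 : NonZero m}} .{{W≢0 : NonZero W}} (T : Subset m) where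

  n : ℕ
  n = ⌈ m / W ⌉

  Ts : List (Fin m)
  Ts = filter (_∈? T) (allFin m)

  Δ : Fin m → ℕ
  Δ t = m ∸ toℕ t

  N : ℕ → Vector Bool m → Vector Bool m
  N d y i = at false y (toℕ i + d)

  U : Vector Bool m → Vector Bool m
  U y i = ⨁ Ts λ t → N (Δ t) y i

  U≢0 : Set
  U≢0 = ¬ (∀ y i → U y i ≡ false)

  V : Vector Bool m → Vector Bool m
  V y i = ⨁ Ts λ t → if does (toℕ t ≤? toℕ i) then at false y (toℕ i ∸ toℕ t) else false

  -- Every Δ t is at most m, so the default m matters only for empty T.
  Δmin : ℕ
  Δmin = min m (map Δ Ts)

  instance
    Δmin≢0 : NonZero Δmin
    Δmin≢0 = >-nonZero (v<min⁺ (>-nonZero⁻¹ m) (map⁺ (universal (λ t → m<n⇒0<n∸m (toℕ<n t)) Ts)))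

  -- ⌈log₂ x⌉ is the least integer k with x ≤ 2ᵏ. As 2ᵏ is an integer for
  -- k ≥ 0, it is unchanged when x ≥ 1 is first rounded up.
  r : ℕ
  r = ⌈log₂ ⌈ m / Δmin ⌉ ⌉

  shift : ℕ → Fin m → ℕ
  shift k t = 2 ^ k * Δ t

  T[_] : ℕ → List (Fin m)
  T[ k ] = filter (λ t → shift k t <? m) Ts

  Sfb : ℕ
  Sfb = ∑[ k ∈ upTo r ] length T[ k ]

  stage : ℕ → Vector Bool m → Vector Bool m
  stage k y i = y i xor ⨁ T[ k ] λ t → N (shift k t) y i

  -- The reduction of L + xᵐ H.
  frobeniusReduction : (L H : Vector Bool m) → Vector Bool m
  frobeniusReduction L H i = L i xor V (foldl (λ y k → stage k y) H (upTo r)) i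

  -- For k ≥ 0 and t in T, shift k t < m forces 2ᵏ < m and hence k < m.
  active : Fin m → List ℕ
  active t = filter (λ k → shift k t <? m) (upTo m)

  a : ℕ → ℕ
  a k = ⌈ m ∸ 2 ^ k * Δmin / W ⌉

  B̂fb : ℕ
  B̂fb = ∑[ t ∈ Ts ] ∑[ k ∈ active t ] ⌈ m ∸ shift k t / W ⌉

  Bfbloop : ℕ
  Bfbloop = ∑[ k ∈ upTo r ] ∑[ t ∈ T[ k ] ] (a k ⊓ (n ∸ shift k t / W))

  BV : ℕ
  BV = ∑[ t ∈ Ts ] (n ∸ toℕ t / W)

  -- Word w holds the coefficient positions i with i / W ≡ w. The positions
  -- affected by the feedback shift d are those below m ∸ d.
  MeetsFeedback : ℕ → Fin n → Set
  MeetsFeedback d w = ∃ λ (i : Fin (m ∸ d)) → toℕ i / W ≡ toℕ w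

  meetsFeedback? : ∀ d → Decidable (MeetsFeedback d)
  meetsFeedback? d w = any? λ i → toℕ i / W ≟ toℕ w

  usefulSupport : ℕ
  usefulSupport = ∑[ t ∈ Ts ] ∑[ k ∈ active t ] count (meetsFeedback? (shift k t)) (allFin n)

  -- Some position affected in stage k lies in word w or above it.
  InRange : ℕ → Fin n → Set
  InRange k w = Any (λ t → ∃ λ (i : Fin (m ∸ shift k t)) → toℕ w ≤ toℕ i / W) T[ k ]

  inRange? : ∀ k → Decidable (InRange k)
  inRange? k w = Any.any? (λ t → any? λ i → toℕ w ≤? toℕ i / W) T[ k ]

  range : ℕ → List (Fin n)
  range k = filter (inRange? k) (allFin n)

  SourceBelowEnd : ℕ → Fin n → Set
  SourceBelowEnd d w = toℕ w + d / W < n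

  sourceBelowEnd? : ∀ d → Decidable (SourceBelowEnd d)
  sourceBelowEnd? d w = toℕ w + d / W <? n

  loopContributions : ℕ
  loopContributions = ∑[ k ∈ upTo r ] ∑[ t ∈ T[ k ] ] count (sourceBelowEnd? (shift k t)) (range k)

  MeetsLow : Fin m → Fin n → Set
  MeetsLow t w = ∃ λ (i : Fin m) → toℕ t ≤ toℕ i × toℕ i / W ≡ toℕ w

  meetsLow? : ∀ t → Decidable (MeetsLow t)
  meetsLow? t w = any? λ i → (toℕ t ≤? toℕ i) ×-dec (toℕ i / W ≟ toℕ w)

  lowTouched : ℕ
  lowTouched = ∑[ t ∈ Ts ] count (meetsLow? t) (allFin n)

  Word : Set
  Word = Vector Bool W

  Packed : ℕ → Set
  Packed p = Vector Word p

  pack : {l : ℕ} → Vector Bool l → Packed ⌈ l / W ⌉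
  pack c w b = at false c (toℕ w * W + toℕ b)

  0ʷ : Word
  0ʷ _ = false

  infixl 6 _⊕_
  _⊕_ : Word → Word → Word
  _⊕_ = zipWith _xor_

  _≫_ _≪_ : Word → ℕ → Word
  (x ≫ s) b = at false x (toℕ b + s)
  (x ≪ s) b = if does (s ≤? toℕ b) then at false x (toℕ b ∸ s) else false

  -- Word w of the packed polynomial x shifted down (division by xᵈ) or up
  -- (multiplication by xᵈ), each assembled from two adjacent source words.
  down up : {p : ℕ} → Packed p → ℕ → ℕ → Word
  down x d w = (at 0ʷ x (w + d / W) ≫ (d % W)) ⊕ (at 0ʷ x (1 + w + d / W) ≪ (W ∸ d % W))
  up x d w = (word (d / W) ≪ (d % W)) ⊕ (word (1 + d / W) ≫ (W ∸ d % W))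
    where
    word : ℕ → Word
    word q = if does (q ≤? w) then at 0ʷ x (w ∸ q) else 0ʷ

  -- Clears the positions from m on.
  mask : Fin n → Word → Word
  mask w x b = does (toℕ w * W + toℕ b <? m) ∧ x b

  -- What an execution reports: one event for each destination word handled by
  -- a pass, and one for each shifted-word contribution.
  data Event : Set where
    extract       : (w : Fin n) → Event
    traverse      : (k : ℕ) (w : Fin n) → Event
    feedbackShift : (k : ℕ) (t : Fin m) (w : Fin n) → Event
    lowShift      : (t : Fin m) (w : Fin n) → Event
    assemble      : (w : Fin n) → Event

  Traced : Set → Set
  Traced S = S × List Event

  forEach : {I S : Set} → List I → (I → S → Traced S) → S → Traced S
  forEach []       body s = s , []
  forEach (x ∷ xs) body s =
    let (s′ , es) = body x s ; (s″ , fs) = forEach xs body s′ in s″ , es ++ fs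

  extractHigh : {p : ℕ} → Packed p → Traced (Packed n)
  extractHigh A = forEach (allFin n)
    (λ w y → updateAt y w (const (down A m (toℕ w))) , extract w ∷ [])
    (const 0ʷ)

  -- The state is overwritten in place, in ascending word order. As a source
  -- index is never below the destination index, and word w is written after
  -- all reads for it, every shift still reads the input of the stage.
  feedbackWord : ℕ → Fin n → Packed n → Traced (Packed n)
  feedbackWord k w y =
    let (x , es) = forEach (filter (λ t → sourceBelowEnd? (shift k t) w) T[ k ])
                     (λ t x → x ⊕ down y (shift k t) (toℕ w) , feedbackShift k t w ∷ [])
                     (y w)
    in updateAt y w (const x) , traverse k w ∷ es

  feedback : Packed n → Traced (Packed n)
  feedback = forEach (upTo r) λ k → forEach (range k) (feedbackWord k)

  assembleLow : {p : ℕ} → Packed p → Packed n → Traced (Packed n)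
  assembleLow A y = forEach (allFin n)
    (λ w out →
      let (x , es) = forEach (filter (λ t → toℕ t / W ≤? toℕ w) Ts)
                       (λ t x → x ⊕ up y (toℕ t) (toℕ w) , lowShift t w ∷ [])
                       (at 0ʷ A (toℕ w))
      in updateAt out w (const (mask w x)) , assemble w ∷ es)
    (const 0ʷ)

  -- The input is a polynomial of degree below 2m.
  execute : Vector Bool (m + m) → Traced (Packed n)
  execute A =
    let (y₀ , es) = extractHigh (pack A)
        (y  , fs) = feedback y₀
        (z  , gs) = assembleLow (pack A) y
    in z , es ++ fs ++ gs

  trace : Vector Bool (m + m) → List Event
  trace A = proj₂ (execute A)

  extractions assemblies : List Event → List (Fin n)
  extractions = mapMaybe λ { (extract w) → just w ; _ → nothing }
  assemblies  = mapMaybe λ { (assemble w) → just w ; _ → nothing }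

  traversals : ℕ → List Event → List (Fin n)
  traversals k = mapMaybe λ
    { (traverse j w) → if does (j ≟ k) then just w else nothing
    ; _ → nothing }

  feedbackShifts : List Event → List (ℕ × Fin m × Fin n)
  feedbackShifts = mapMaybe λ { (feedbackShift k t w) → just (k , t , w) ; _ → nothing }

  lowShifts : List Event → List (Fin m × Fin n)
  lowShifts = mapMaybe λ { (lowShift t w) → just (t , w) ; _ → nothing }

  Implements : Vector Bool (m + m) → Set
  Implements A = ∀ w b → proj₁ (execute A) w b
                       ≡ pack (frobeniusReduction (A ∘ (_↑ˡ m)) (A ∘ (m ↑ʳ_))) w b

  implements? : Decidable Implements
  implements? A = all? λ w → all? λ b → _ ≟ᵇ _

-- A sanity check: for m = 3, W = 2 and T = {0,1,2}, the execution computes the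
-- packed reduction of every input.
private
  open Reduction 3 2 ⊤ using (implements?)

  inputs : (l : ℕ) → List (Vec Bool l)
  inputs 0       = [ Vec.[] ]
  inputs (suc l) = map (false Vec.∷_) (inputs l) ++ map (true Vec.∷_) (inputs l)

  _ : length (filter (implements? ∘ Vec.lookup) (inputs 6)) ≡ 64
  _ = refl

{-# OPTIONS --safe #-}
module Submission where

-- Positions 0, …, x − 1 occupy the words w with w W < x, that is, w < ⌈x / W⌉;
-- so every word set in question is an interval of words. The bounds compare,
-- for d = 2ᵏ Δ t, the terms ⌈(m − d) / W⌉ and min (a k) (n − ⌊d / W⌋): the
-- first is at most n − ⌊d / W⌋, which in turn exceeds it by at most 1. As
-- k < r holds exactly when 2ᵏ Δmin < m, summing over stages or over terms of g
-- counts the same shifts, and every stage k < r contains the shift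
-- 2ᵏ Δmin, whose term is a k. The trace does not depend on the state of the
-- computation, so each loop emits the concatenation of the events of its words.

open import Data.Bool.Base using (Bool; true; false; _xor_; if_then_else_)
open import Data.Fin.Base using (Fin; zero; suc; toℕ; fromℕ<)
open import Data.Fin.Properties using (toℕ<n; toℕ-fromℕ<)
open import Data.Fin.Subset using (Subset)
open import Data.List.Base using (List; []; _∷_; [_]; _∷ʳ_; _++_; map; filter; length; upTo; allFin; tabulate; concatMap; mapMaybe)
open import Data.List.Extrema.Nat using (min≤xs; argmin-sel)
open import Data.List.Membership.Propositional using (_∈_; lose; find)
open import Data.List.Membership.Propositional.Properties using (∈-filter⁺; ∈-filter⁻; ∈-map⁺; ∈-map⁻; ∈-upTo⁺; ∈-upTo⁻)
open import Data.List.Properties using (length-++; length-tabulate; filter-++; filter-all; filter-none; filter-accept; filter-reject; concatMap-pure; ++-identityʳ; mapMaybe-++; upTo-∷ʳ)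
open import Data.List.Relation.Unary.All as All using (All; []; _∷_)
open import Data.List.Relation.Unary.All.Properties using (tabulate⁺)
open import Data.List.Relation.Unary.AllPairs using (_∷_)
open import Data.List.Relation.Unary.Any using (here; there)
open import Data.List.Relation.Unary.Unique.Propositional using (Unique)
open import Data.List.Relation.Unary.Unique.Propositional.Properties using (upTo⁺)
open import Data.Maybe.Base using (Maybe)
open import Data.Nat.Base using (ℕ; zero; suc; _+_; _*_; _∸_; _^_; _⊓_; _≤_; _<_; _/_; _%_; _≤′_; ≤′-refl; ≤′-step; ⌈_/2⌉; z≤n; s≤s; s≤s⁻¹; s<s⁻¹; NonZero; >-nonZero⁻¹)
open import Data.Nat.DivMod using (m/n*n≤m; m*n/n≡m; /-monoˡ-≤; m<n*o⇒m/o<n; m≡m%n+[m/n]*n; m%n<n)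
open import Data.Nat.Logarithm using (⌈log₂_⌉; ⌈log₂⌉-mono-≤; ⌈log₂2^n⌉≡n; ⌈log₂⌈n/2⌉⌉≡⌈log₂n⌉∸1)
open import Data.Nat.Properties
open import Algebra.Properties.CommutativeSemigroup +-commutativeSemigroup using (interchange)
open import Data.Product.Base using (_,_; ∃; _×_; proj₁; proj₂)
open import Data.Sum.Base using (inj₁; inj₂)
open import Data.Vec.Functional using (Vector)
open import Function.Base using (_∘_; const; id)
open import Relation.Binary.PropositionalEquality using (_≡_; _≢_; refl; sym; trans; cong; cong₂; subst; module ≡-Reasoning)
open import Relation.Nullary using (¬_; yes; no; does; contradiction; _×-dec_)
open import Relation.Nullary.Decidable using (dec-true; dec-false)
open import Relation.Unary using (Decidable)
open import Defs

private variable
  I J : Set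

-- Sums and counts over lists and intervals of indices.

∑-cong : (xs : List I) {f g : I → ℕ} → (∀ {x} → x ∈ xs → f x ≡ g x) → ∑ xs f ≡ ∑ xs g
∑-cong []       f≡g = refl
∑-cong (x ∷ xs) f≡g = cong₂ _+_ (f≡g (here refl)) (∑-cong xs (f≡g ∘ there))

∑-mono-≤ : (xs : List I) {f g : I → ℕ} → (∀ {x} → x ∈ xs → f x ≤ g x) → ∑ xs f ≤ ∑ xs g
∑-mono-≤ []       f≤g = z≤n
∑-mono-≤ (x ∷ xs) f≤g = +-mono-≤ (f≤g (here refl)) (∑-mono-≤ xs (f≤g ∘ there))

∑-distrib-+ : (xs : List I) (f g : I → ℕ) → ∑ xs (λ x → f x + g x) ≡ ∑ xs f + ∑ xs g
∑-distrib-+ []       f g = refl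
∑-distrib-+ (x ∷ xs) f g =
  trans (cong (f x + g x +_) (∑-distrib-+ xs f g)) (interchange (f x) (g x) (∑ xs f) (∑ xs g))

∑-zero : (xs : List I) → ∑ xs (const 0) ≡ 0
∑-zero []       = refl
∑-zero (x ∷ xs) = ∑-zero xs

∑-one : (xs : List I) → ∑ xs (const 1) ≡ length xs
∑-one []       = refl
∑-one (x ∷ xs) = cong suc (∑-one xs)

-- Isolates one stage: stages are listed without repetition, and none other than `k` emits
-- `traverse k`.
∑-single : {xs : List I} {x : I} (f : I → ℕ) → Unique xs → x ∈ xs →
           (∀ {y} → y ≢ x → f y ≡ 0) → ∑ xs f ≡ f x
∑-single {xs = x ∷ xs} f (x∉xs ∷ _) (here refl) f≡0 =
  trans (cong (f x +_) (trans (∑-cong xs λ y∈xs → f≡0 (All.lookup x∉xs y∈xs ∘ sym)) (∑-zero xs)))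
        (+-identityʳ (f x))
∑-single f (y∉xs ∷ unique) (there x∈xs) f≡0 =
  cong₂ _+_ (f≡0 (All.lookup y∉xs x∈xs)) (∑-single f unique x∈xs f≡0)

∈⇒≤∑ : {xs : List I} {x : I} (f : I → ℕ) → x ∈ xs → f x ≤ ∑ xs f
∈⇒≤∑ f (here refl)          = m≤m+n _ _
∈⇒≤∑ f (there {x = y} x∈xs) = ≤-trans (∈⇒≤∑ f x∈xs) (m≤n+m _ (f y))

∑-filter : {P : I → Set} (P? : Decidable P) (xs : List I) (f : I → ℕ) →
           ∑ (filter P? xs) f ≡ ∑ xs (λ x → if does (P? x) then f x else 0)
∑-filter P? []       f = refl
∑-filter P? (x ∷ xs) f with does (P? x)
... | true  = cong (f x +_) (∑-filter P? xs f)
... | false = ∑-filter P? xs f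

-- Double counting of related pairs with weights `f`. It exchanges terms and stages although each
-- inner list depends on the outer index.
∑-filter-swap : {R : I → J → Set} (R? : ∀ x → Decidable (R x)) (xs : List I) (ys : List J)
                (f : I → J → ℕ) →
                ∑ xs (λ x → ∑ (filter (R? x) ys) (f x)) ≡
                ∑ ys (λ y → ∑ (filter (λ x → R? x y) xs) (λ x → f x y))
∑-filter-swap R? []       ys f = sym (∑-zero ys)
∑-filter-swap R? (x ∷ xs) ys f = begin
  ∑ (filter (R? x) ys) (f x) + ∑ xs (λ x → ∑ (filter (R? x) ys) (f x))
    ≡⟨ cong₂ _+_ (∑-filter (R? x) ys (f x)) (∑-filter-swap R? xs ys f) ⟩
  ∑ ys (λ y → if does (R? x y) then f x y else 0) +
  ∑ ys (λ y → ∑ (filter (λ x → R? x y) xs) (λ x → f x y))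
    ≡⟨ ∑-distrib-+ ys _ _ ⟨
  ∑ ys (λ y → (if does (R? x y) then f x y else 0) +
              ∑ (filter (λ x → R? x y) xs) (λ x → f x y))
    ≡⟨ ∑-cong ys (λ {y} _ → column y) ⟩
  ∑ ys (λ y → ∑ (filter (λ x → R? x y) (x ∷ xs)) (λ x → f x y)) ∎
  where
  open ≡-Reasoning
  column : ∀ y → (if does (R? x y) then f x y else 0) +
                 ∑ (filter (λ x → R? x y) xs) (λ x → f x y)
               ≡ ∑ (filter (λ x → R? x y) (x ∷ xs)) (λ x → f x y)
  column y with does (R? x y)
  ... | true  = refl
  ... | false = refl

-- Weight 1: an execution emits its shifts word by word, whereas the formulas count them shift by
-- shift.
count-swap : {R : I → J → Set} (R? : ∀ x → Decidable (R x)) (xs : List I) (ys : List J) →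
             ∑ xs (λ x → count (R? x) ys) ≡ ∑ ys (λ y → count (λ x → R? x y) xs)
count-swap R? xs ys = begin
  ∑ xs (λ x → count (R? x) ys)
    ≡⟨ ∑-cong xs (λ {x} _ → ∑-one (filter (R? x) ys)) ⟨
  ∑ xs (λ x → ∑ (filter (R? x) ys) (const 1))
    ≡⟨ ∑-filter-swap R? xs ys (λ _ _ → 1) ⟩
  ∑ ys (λ y → ∑ (filter (λ x → R? x y) xs) (const 1))
    ≡⟨ ∑-cong ys (λ {y} _ → ∑-one (filter (λ x → R? x y) xs)) ⟩
  ∑ ys (λ y → count (λ x → R? x y) xs) ∎
  where open ≡-Reasoning

-- Lets the cut-off `m` in `active` be lowered to `r`: the entries from `i` on are rejected one by
-- one.
filter-upTo : {P : ℕ → Set} (P? : Decidable P) {i j : ℕ} → i ≤ j → (∀ {k} → P k → k < i) →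
              filter P? (upTo j) ≡ filter P? (upTo i)
filter-upTo {P} P? {i} i≤j bound = go (≤⇒≤′ i≤j)
  where
  go : ∀ {j} → i ≤′ j → filter P? (upTo j) ≡ filter P? (upTo i)
  go ≤′-refl = refl
  go {suc j} (≤′-step i≤′j) = begin
    filter P? (upTo (suc j))                ≡⟨ cong (filter P?) (upTo-∷ʳ j) ⟨
    filter P? (upTo j ∷ʳ j)                 ≡⟨ filter-++ P? (upTo j) [ j ] ⟩
    filter P? (upTo j) ++ filter P? [ j ]   ≡⟨ cong₂ _++_ (go i≤′j) (filter-reject P? ¬Pj) ⟩
    filter P? (upTo i) ++ []                ≡⟨ ++-identityʳ _ ⟩
    filter P? (upTo i)                      ∎
    where
    open ≡-Reasoning
    ¬Pj : ¬ P j
    ¬Pj Pj = <⇒≱ (bound Pj) (≤′⇒≤ i≤′j)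

-- Stated for `tabulate f` because the tail of `allFin (suc n)` tabulates `suc` and is no longer an
-- `allFin`; `P` is tested at `f i`, the bound at `i`.
count-< : ∀ n {c} {f : Fin n → I} {P : I → Set} (P? : Decidable P) → c ≤ n →
          (∀ i → P (f i) → toℕ i < c) → (∀ i → toℕ i < c → P (f i)) →
          count P? (tabulate f) ≡ c
count-< n       {zero}  P? c≤n to from =
  cong length (filter-none P? (tabulate⁺ λ i Pfi → n≮0 (to i Pfi)))
count-< (suc n) {suc c} P? c≤n to from =
  trans (cong length (filter-accept P? (from zero (s≤s z≤n))))
        (cong suc (count-< n P? (s≤s⁻¹ c≤n) (λ i → s<s⁻¹ ∘ to (suc i)) (λ i → from (suc i) ∘ s≤s)))

count-≥ : ∀ n {c} {f : Fin n → I} {P : I → Set} (P? : Decidable P) →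
          (∀ i → P (f i) → c ≤ toℕ i) → (∀ i → c ≤ toℕ i → P (f i)) →
          count P? (tabulate f) ≡ n ∸ c
count-≥ n       {zero}  {f} P? to from =
  trans (cong length (filter-all P? (tabulate⁺ λ i → from i z≤n))) (length-tabulate f)
-- The interval starts past the end, and `0 ∸ suc c` is 0.
count-≥ zero    {suc c} P? to from = refl
count-≥ (suc n) {suc c} P? to from =
  trans (cong length (filter-reject P? (n≮0 ∘ to zero)))
        (count-≥ n P? (λ i → s≤s⁻¹ ∘ to (suc i)) (λ i → from (suc i) ∘ s≤s))

filter-∩ : {P Q : I → Set} (P? : Decidable P) (Q? : Decidable Q) (xs : List I) →
           filter Q? (filter P? xs) ≡ filter (λ x → P? x ×-dec Q? x) xs
filter-∩ P? Q? []       = refl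
filter-∩ P? Q? (x ∷ xs) with does (P? x)
... | false = filter-∩ P? Q? xs
... | true with does (Q? x)
...   | false = filter-∩ P? Q? xs
...   | true  = cong (x ∷_) (filter-∩ P? Q? xs)

⨁-false : (xs : List I) {f : I → Bool} → (∀ {x} → x ∈ xs → f x ≡ false) → ⨁ xs f ≡ false
⨁-false []       f≡0 = refl
⨁-false (x ∷ xs) f≡0 = cong₂ _xor_ (f≡0 (here refl)) (⨁-false xs (f≡0 ∘ there))

at-≥ : {l : ℕ} (z : I) (v : Vector I l) {i : ℕ} → l ≤ i → at z v i ≡ z
at-≥ {l = l} z v {i} l≤i with i <? l
... | yes i<l = contradiction l≤i (<⇒≱ i<l)
... | no  _   = refl

-- Lengths and selections of concatenated lists.

length-concatMap : (f : I → List J) (xs : List I) → length (concatMap f xs) ≡ ∑ xs (length ∘ f)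
length-concatMap f []       = refl
length-concatMap f (x ∷ xs) =
  trans (length-++ (f x)) (cong (length (f x) +_) (length-concatMap f xs))

length-concatMap-[_] : {f : I → J} (xs : List I) → length (concatMap ([_] ∘ f) xs) ≡ length xs
length-concatMap-[ []     ] = refl
length-concatMap-[ x ∷ xs ] = cong suc length-concatMap-[ xs ]

concatMap-[] : (xs : List I) → concatMap {B = J} (const []) xs ≡ []
concatMap-[] []       = refl
concatMap-[] (x ∷ xs) = concatMap-[] xs

-- A selection of events passes through one loop level at a time, so nested loops are handled by
-- nesting this lemma.
mapMaybe-concatMap : {K : Set} (p : J → Maybe K) {f : I → List J} {g : I → List K} (xs : List I) →
                     (∀ x → mapMaybe p (f x) ≡ g x) → mapMaybe p (concatMap f xs) ≡ concatMap g xs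
mapMaybe-concatMap p         []       eq = refl
mapMaybe-concatMap p {f} {g} (x ∷ xs) eq =
  trans (mapMaybe-++ p (f x) (concatMap f xs)) (cong₂ _++_ (eq x) (mapMaybe-concatMap p xs eq))

mapMaybe-concatMap-[] : {K : Set} (p : J → Maybe K) {f : I → List J} (xs : List I) →
                        (∀ x → mapMaybe p (f x) ≡ []) → mapMaybe p (concatMap f xs) ≡ []
mapMaybe-concatMap-[] p xs eq = trans (mapMaybe-concatMap p xs eq) (concatMap-[] xs)

-- Rounded division by the word width.

module _ {n : ℕ} .{{_ : NonZero n}} where

  -- With `≤*⇒⌈/⌉≤`, the Galois connection between rounding up and multiplication by `n`. The
  -- remainder of `m + (n ∸ 1)` is at most `n ∸ 1`, which cancels the added `n ∸ 1`.
  ⌈/⌉≤⇒≤* : ∀ {m c} → ⌈ m / n ⌉ ≤ c → m ≤ c * n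
  ⌈/⌉≤⇒≤* {m} {c} le = +-cancelʳ-≤ (n ∸ 1) m (c * n) (begin
    m + (n ∸ 1)                                       ≡⟨ m≡m%n+[m/n]*n (m + (n ∸ 1)) n ⟩
    (m + (n ∸ 1)) % n + ⌈ m / n ⌉ * n
      ≤⟨ +-mono-≤ (pred-mono-≤ (m%n<n (m + (n ∸ 1)) n)) (*-monoˡ-≤ n le) ⟩
    (n ∸ 1) + c * n                                   ≡⟨ +-comm (n ∸ 1) (c * n) ⟩
    c * n + (n ∸ 1)                                   ∎)
    where open ≤-Reasoning

  ≤*⇒⌈/⌉≤ : ∀ {m c} → m ≤ c * n → ⌈ m / n ⌉ ≤ c
  ≤*⇒⌈/⌉≤ {m} {c} le = s≤s⁻¹ (m<n*o⇒m/o<n {n = suc c} (begin-strict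
    -- With `o = 0`, monotonicity of `∸` reads `n ∸ 1 < n`.
    m + (n ∸ 1)     <⟨ +-mono-≤-< le (∸-monoʳ-< {o = 0} (s≤s z≤n) (>-nonZero⁻¹ n)) ⟩
    c * n + n       ≡⟨ +-comm (c * n) n ⟩
    suc c * n       ∎))
    where open ≤-Reasoning

  -- With its converse: word `c` starts below position `m` exactly when it is one of the first
  -- `⌈ m / n ⌉` words.
  <⌈/⌉⇒*< : ∀ {m c} → c < ⌈ m / n ⌉ → c * n < m
  <⌈/⌉⇒*< lt = ≰⇒> (<⇒≱ lt ∘ ≤*⇒⌈/⌉≤)

  *<⇒<⌈/⌉ : ∀ {m c} → c * n < m → c < ⌈ m / n ⌉
  *<⇒<⌈/⌉ lt = ≰⇒> (<⇒≱ lt ∘ ⌈/⌉≤⇒≤*)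

  ≤/⇒*≤ : ∀ {m c} → c ≤ m / n → c * n ≤ m
  ≤/⇒*≤ {m} le = ≤-trans (*-monoˡ-≤ n le) (m/n*n≤m m n)

  *≤⇒≤/ : ∀ {m c} → c * n ≤ m → c ≤ m / n
  *≤⇒≤/ {c = c} le = subst (_≤ _) (m*n/n≡m c n) (/-monoˡ-≤ n le)

  ⌈/⌉-mono-≤ : ∀ {l m} → l ≤ m → ⌈ l / n ⌉ ≤ ⌈ m / n ⌉
  ⌈/⌉-mono-≤ l≤m = ≤*⇒⌈/⌉≤ (≤-trans l≤m (⌈/⌉≤⇒≤* ≤-refl))

  -- Rounding `m` up and `d` down to multiples of `n` only enlarges the difference, which is then
  -- itself a multiple.
  ⌈∸/⌉≤ : ∀ m d → ⌈ m ∸ d / n ⌉ ≤ ⌈ m / n ⌉ ∸ d / n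
  ⌈∸/⌉≤ m d = ≤*⇒⌈/⌉≤ (begin
    m ∸ d                          ≤⟨ ∸-mono (⌈/⌉≤⇒≤* {m} ≤-refl) (m/n*n≤m d n) ⟩
    ⌈ m / n ⌉ * n ∸ d / n * n      ≡⟨ *-distribʳ-∸ n ⌈ m / n ⌉ (d / n) ⟨
    (⌈ m / n ⌉ ∸ d / n) * n        ∎)
    where open ≤-Reasoning

  -- Covering `d` by whole words takes at most one word more than `d / n`. This 1, once per active
  -- pair, becomes `Sfb`.
  ≤⌈∸/⌉+1 : ∀ m d → ⌈ m / n ⌉ ∸ d / n ≤ ⌈ m ∸ d / n ⌉ + 1
  ≤⌈∸/⌉+1 m d = m≤n+o⇒m∸n≤o _ (d / n) (≤*⇒⌈/⌉≤ (begin
    m                                       ≤⟨ m≤n+m∸n m d ⟩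
    d + (m ∸ d)                             ≤⟨ +-mono-≤ (<⇒≤ d<) (⌈/⌉≤⇒≤* {m ∸ d} ≤-refl) ⟩
    suc (d / n) * n + ⌈ m ∸ d / n ⌉ * n     ≡⟨ *-distribʳ-+ n (suc (d / n)) ⌈ m ∸ d / n ⌉ ⟨
    (suc (d / n) + ⌈ m ∸ d / n ⌉) * n       ≡⟨ cong (_* n) (+-suc (d / n) ⌈ m ∸ d / n ⌉) ⟨
    (d / n + suc ⌈ m ∸ d / n ⌉) * n         ≡⟨ cong (λ c → (d / n + c) * n) (+-comm 1 ⌈ m ∸ d / n ⌉) ⟩
    (d / n + (⌈ m ∸ d / n ⌉ + 1)) * n       ∎))
    where
    open ≤-Reasoning
    d< : d < suc (d / n) * n
    d< = ≰⇒> (λ le → <-irrefl refl (*≤⇒≤/ le))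

-- Truncated subtraction, the binary logarithm and powers of two.

m<n∸o⇒m+o<n : ∀ {m n o} → m < n ∸ o → m + o < n
m<n∸o⇒m+o<n {m} {n} {o} lt = ≰⇒> λ n≤m+o →
  <⇒≱ lt (m≤n+o⇒m∸n≤o n o (subst (n ≤_) (+-comm m o) n≤m+o))

-- Induction on `k`: replacing `n` by `⌈ n /2⌉` lowers the rounded logarithm by 1. At `k = 0`,
-- `n ≥ 2` would give a logarithm of at least 1.
⌈log₂⌉≤⇒≤2^ : ∀ k {n} → ⌈log₂ n ⌉ ≤ k → n ≤ 2 ^ k
⌈log₂⌉≤⇒≤2^ zero    le = ≮⇒≥ λ 2≤n → n≮0 (≤-trans (⌈log₂⌉-mono-≤ 2≤n) le)
⌈log₂⌉≤⇒≤2^ (suc k) {n} le = begin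
  n                           ≡⟨ ⌊n/2⌋+⌈n/2⌉≡n n ⟨
  _ + ⌈ n /2⌉                 ≤⟨ +-monoˡ-≤ ⌈ n /2⌉ (⌊n/2⌋≤⌈n/2⌉ n) ⟩
  ⌈ n /2⌉ + ⌈ n /2⌉           ≤⟨ +-mono-≤ half half ⟩
  2 ^ k + 2 ^ k               ≡⟨ cong (2 ^ k +_) (+-identityʳ (2 ^ k)) ⟨
  2 ^ suc k                   ∎
  where
  open ≤-Reasoning
  half : ⌈ n /2⌉ ≤ 2 ^ k
  half = ⌈log₂⌉≤⇒≤2^ k (subst (_≤ k) (sym (⌈log₂⌈n/2⌉⌉≡⌈log₂n⌉∸1 n)) (∸-monoˡ-≤ 1 le))

n<2^n : ∀ n → n < 2 ^ n
n<2^n zero    = s≤s z≤n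
n<2^n (suc n) = begin
  suc (suc n)       ≤⟨ +-mono-≤ (m^n>0 2 n) (n<2^n n) ⟩
  2 ^ n + 2 ^ n     ≡⟨ cong (2 ^ n +_) (+-identityʳ (2 ^ n)) ⟨
  2 ^ suc n         ∎
  where open ≤-Reasoning

-- Words met by a single shift.

module _ (m W : ℕ) .{{_ : NonZero m}} .{{_ : NonZero W}} (T : Subset m) where
  open Reduction m W T

  -- The affected positions form an initial interval, so a word meets them exactly when its first
  -- position `w * W` is among them; that position is the witness.
  count-meetsFeedback : ∀ d → count (meetsFeedback? d) (allFin n) ≡ ⌈ m ∸ d / W ⌉
  count-meetsFeedback d = count-< n (meetsFeedback? d) (⌈/⌉-mono-≤ (m∸n≤m m d)) to from
    where
    to : ∀ w → MeetsFeedback d w → toℕ w < ⌈ m ∸ d / W ⌉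
    to w (i , i/W≡w) = *<⇒<⌈/⌉ (≤-<-trans (≤/⇒*≤ (≤-reflexive (sym i/W≡w))) (toℕ<n i))
    from : ∀ w → toℕ w < ⌈ m ∸ d / W ⌉ → MeetsFeedback d w
    from w w< = fromℕ< w*W< , trans (cong (_/ W) (toℕ-fromℕ< w*W<)) (m*n/n≡m (toℕ w) W)
      where w*W< = <⌈/⌉⇒*< w<

  usefulSupport≡B̂fb : usefulSupport ≡ B̂fb
  usefulSupport≡B̂fb = ∑-cong Ts λ {t} _ → ∑-cong (active t) λ {k} _ → count-meetsFeedback (shift k t)

  count-meetsLow : ∀ t → count (meetsLow? t) (allFin n) ≡ n ∸ toℕ t / W
  count-meetsLow t = count-≥ n (meetsLow? t) to from
    where
    to : ∀ w → MeetsLow t w → toℕ t / W ≤ toℕ w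
    to w (i , t≤i , i/W≡w) = subst (_ ≤_) i/W≡w (/-monoˡ-≤ W t≤i)
    from : ∀ w → toℕ t / W ≤ toℕ w → MeetsLow t w
    -- The word of `t` is met at `t` itself, which need not be its first position; a later word is
    -- met at its first position, which cannot be below `t`.
    from w t/W≤w with m≤n⇒m<n∨m≡n t/W≤w
    ... | inj₂ t/W≡w = t , ≤-refl , t/W≡w
    ... | inj₁ t/W<w = fromℕ< w*W<m
                     , subst (toℕ t ≤_) (sym i≡w*W) (≮⇒≥ λ w*W<t → <⇒≱ t/W<w (*≤⇒≤/ (<⇒≤ w*W<t)))
                     , trans (cong (_/ W) i≡w*W) (m*n/n≡m (toℕ w) W)
      where
      w*W<m = <⌈/⌉⇒*< (toℕ<n w)
      i≡w*W = toℕ-fromℕ< w*W<m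

  lowTouched≡BV : lowTouched ≡ BV
  lowTouched≡BV = ∑-cong Ts λ {t} _ → count-meetsLow t

  -- The least shift and the number of stages.

  Δmin≤Δ : ∀ {t} → t ∈ Ts → Δmin ≤ Δ t
  Δmin≤Δ t∈Ts = All.lookup (min≤xs m (map Δ Ts)) (∈-map⁺ Δ t∈Ts)

  shiftMin≤shift : ∀ k {t} → t ∈ T[ k ] → 2 ^ k * Δmin ≤ shift k t
  shiftMin≤shift k t∈Tk = *-monoʳ-≤ (2 ^ k) (Δmin≤Δ (proj₁ (∈-filter⁻ (λ t → shift k t <? m) t∈Tk)))

  -- If even the least shift were at least `m`, every shift would read past the end, where `at`
  -- returns `false`, and `U` would vanish.
  U≢0⇒Δmin<m : U≢0 → Δmin < m
  U≢0⇒Δmin<m U≢0 = ≰⇒> λ m≤Δmin → U≢0 λ y i → ⨁-false Ts λ t∈Ts →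
    at-≥ false y (≤-trans m≤Δmin (≤-trans (Δmin≤Δ t∈Ts) (m≤n+m _ (toℕ i))))

  Δmin<m⇒∃ : Δmin < m → ∃ λ t → t ∈ Ts × Δmin ≡ Δ t
  Δmin<m⇒∃ Δmin<m with argmin-sel id m (map Δ Ts)
  -- The default `m` of the minimum is excluded by strictness.
  ... | inj₁ Δmin≡m = contradiction Δmin≡m (<⇒≢ Δmin<m)
  ... | inj₂ Δmin∈  = ∈-map⁻ Δ Δmin∈

  -- This and its converse pass between `k < r` and `2 ^ k * Δmin < m` through
  -- `2 ^ k < ⌈ m / Δmin ⌉`.
  <r⇒shiftMin<m : ∀ {k} → k < r → 2 ^ k * Δmin < m
  <r⇒shiftMin<m {k} k<r = <⌈/⌉⇒*< {Δmin} {c = 2 ^ k} (≰⇒> λ le →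
    <⇒≱ k<r (≤-trans (⌈log₂⌉-mono-≤ le) (≤-reflexive (⌈log₂2^n⌉≡n k))))

  shiftMin<m⇒<r : ∀ {k} → 2 ^ k * Δmin < m → k < r
  shiftMin<m⇒<r {k} lt = ≰⇒> λ r≤k → <⇒≱ (*<⇒<⌈/⌉ {Δmin} {c = 2 ^ k} lt) (⌈log₂⌉≤⇒≤2^ k r≤k)

  -- Otherwise stage `m` would satisfy `2 ^ m ≤ 2 ^ m * Δmin < m`, against `m < 2 ^ m`. Hence
  -- `upTo m` in `active` misses no stage.
  r≤m : r ≤ m
  r≤m = ≮⇒≥ λ m<r → <-asym (n<2^n m) (≤-<-trans (m≤m*n (2 ^ m) Δmin) (<r⇒shiftMin<m m<r))

  -- Comparison of the useful support with the loop count.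

  B̂fb-byStage : B̂fb ≡ ∑[ k ∈ upTo r ] ∑[ t ∈ T[ k ] ] ⌈ m ∸ shift k t / W ⌉
  B̂fb-byStage = trans
    (∑-cong Ts λ {t} t∈Ts → cong (λ ks → ∑ ks λ k → ⌈ m ∸ shift k t / W ⌉)
      -- An active shift forces `2 ^ k * Δmin < m`, hence `k < r`. After this cut-off, the swap
      -- turns the active stages of `t` into the lists `T[ k ]`.
      (filter-upTo (λ k → shift k t <? m) r≤m
        λ {k} lt → shiftMin<m⇒<r (≤-<-trans (*-monoʳ-≤ (2 ^ k) (Δmin≤Δ t∈Ts)) lt)))
    (∑-filter-swap (λ t k → shift k t <? m) Ts (upTo r) (λ t k → ⌈ m ∸ shift k t / W ⌉))

  -- Both entries of the minimum dominate the useful count: `a k` because no shift of the stage is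
  -- below `2 ^ k * Δmin`, the other by rounding.
  B̂fb≤Bfbloop : B̂fb ≤ Bfbloop
  B̂fb≤Bfbloop = ≤-trans (≤-reflexive B̂fb-byStage)
    (∑-mono-≤ (upTo r) λ {k} _ → ∑-mono-≤ T[ k ] λ {t} t∈Tk →
      ⊓-glb (⌈/⌉-mono-≤ (∸-monoʳ-≤ m (shiftMin≤shift k t∈Tk))) (⌈∸/⌉≤ m (shift k t)))

  Bfbloop≤B̂fb+Sfb : Bfbloop ≤ B̂fb + Sfb
  Bfbloop≤B̂fb+Sfb = begin
    Bfbloop
      ≤⟨ ∑-mono-≤ (upTo r) (λ {k} _ → ∑-mono-≤ T[ k ] λ {t} _ →
           ≤-trans (m⊓n≤n (a k) _) (≤⌈∸/⌉+1 m (shift k t))) ⟩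
    ∑[ k ∈ upTo r ] ∑[ t ∈ T[ k ] ] (⌈ m ∸ shift k t / W ⌉ + 1)
      ≡⟨ ∑-cong (upTo r) (λ {k} _ → trans
           (∑-distrib-+ T[ k ] (λ t → ⌈ m ∸ shift k t / W ⌉) (const 1))
           (cong (∑ T[ k ] (λ t → ⌈ m ∸ shift k t / W ⌉) +_) (∑-one T[ k ]))) ⟩
    ∑[ k ∈ upTo r ] ((∑[ t ∈ T[ k ] ] ⌈ m ∸ shift k t / W ⌉) + length T[ k ])
      ≡⟨ ∑-distrib-+ (upTo r) _ _ ⟩
    (∑[ k ∈ upTo r ] ∑[ t ∈ T[ k ] ] ⌈ m ∸ shift k t / W ⌉) + Sfb
      ≡⟨ cong (_+ Sfb) B̂fb-byStage ⟨
    B̂fb + Sfb ∎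
    where open ≤-Reasoning

  -- Words traversed in a stage.

  inRange⇒<a : ∀ k w → InRange k w → toℕ w < a k
  inRange⇒<a k w w∈ =
    let t , t∈Tk , i , w≤i/W = find w∈
    in *<⇒<⌈/⌉ (<-≤-trans (≤-<-trans (≤/⇒*≤ w≤i/W) (toℕ<n i)) (∸-monoʳ-≤ m (shiftMin≤shift k t∈Tk)))

  a≤n : ∀ k → a k ≤ n
  a≤n k = ⌈/⌉-mono-≤ (m∸n≤m m (2 ^ k * Δmin))

  module _ (Δmin<m : Δmin < m) where

    -- A term attaining `Δmin` is active in every stage below `r`. It affects the most positions, so
    -- it alone spans the range.
    ∃shiftMin : ∀ {k} → k < r → ∃ λ t → t ∈ T[ k ] × 2 ^ k * Δmin ≡ shift k t
    ∃shiftMin {k} k<r =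
      let t , t∈Ts , Δmin≡Δt = Δmin<m⇒∃ Δmin<m
          min≡shift          = cong (2 ^ k *_) Δmin≡Δt
      in t , ∈-filter⁺ (λ t → shift k t <? m) t∈Ts (subst (_< m) min≡shift (<r⇒shiftMin<m k<r)) , min≡shift

    <a⇒inRange : ∀ {k} → k < r → ∀ w → toℕ w < a k → InRange k w
    <a⇒inRange {k} k<r w w<a =
      let t , t∈Tk , min≡shift = ∃shiftMin k<r
          w*W<                 = subst (λ d → toℕ w * W < m ∸ d) min≡shift (<⌈/⌉⇒*< w<a)
      -- The witness is the first position of word `w`, under the least shift of the stage.
      in lose t∈Tk (fromℕ< w*W< , *≤⇒≤/ (≤-reflexive (sym (toℕ-fromℕ< w*W<))))

    length-range : ∀ {k} → k < r → length (range k) ≡ a k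
    length-range {k} k<r = count-< n (inRange? k) (a≤n k) (inRange⇒<a k) (<a⇒inRange k<r)

    -- The range and the source test are two upper bounds on `w`; together they cut out an initial
    -- interval whose length is the minimum.
    count-sourceBelowEnd : ∀ {k} → k < r → ∀ d →
                           count (sourceBelowEnd? d) (range k) ≡ a k ⊓ (n ∸ d / W)
    count-sourceBelowEnd {k} k<r d = trans
      (cong length (filter-∩ (inRange? k) (sourceBelowEnd? d) (allFin n)))
      (count-< n (λ w → inRange? k w ×-dec sourceBelowEnd? d w) (≤-trans (m⊓n≤m (a k) _) (a≤n k))
        (λ w (w∈ , w+q<n) → ⊓-pres-m< (inRange⇒<a k w w∈) (m+n≤o⇒m≤o∸n (suc (toℕ w)) w+q<n))
        (λ w w< → <a⇒inRange k<r w (m<n⊓o⇒m<n _ _ w<) , m<n∸o⇒m+o<n (m<n⊓o⇒m<o _ _ w<)))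

    loopContributions≡Bfbloop : loopContributions ≡ Bfbloop
    loopContributions≡Bfbloop = ∑-cong (upTo r) λ {k} k∈ → ∑-cong T[ k ] λ {t} _ →
      count-sourceBelowEnd (∈-upTo⁻ k∈) (shift k t)

    -- For the least shift the second entry is at least `a k`, so its term alone accounts for the
    -- stage.
    ∑a≤Bfbloop : (∑[ k ∈ upTo r ] a k) ≤ Bfbloop
    ∑a≤Bfbloop = ∑-mono-≤ (upTo r) λ {k} k∈ →
      let t , t∈Tk , min≡shift = ∃shiftMin (∈-upTo⁻ k∈)
          a≤ = subst (λ d → a k ≤ n ∸ d / W) min≡shift (⌈∸/⌉≤ m (2 ^ k * Δmin))
      in ≤-trans (⊓-glb ≤-refl a≤) (∈⇒≤∑ (λ t → a k ⊓ (n ∸ shift k t / W)) t∈Tk)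

  -- Events emitted by the execution.

  forEach-trace : {S : Set} (xs : List I) {body : I → S → Traced S} {events : I → List Event} →
                  (∀ x s → proj₂ (body x s) ≡ events x) →
                  ∀ s → proj₂ (forEach xs body s) ≡ concatMap events xs
  forEach-trace []       eq s = refl
  -- The `_` is the state left by `body x s`; `eq` holds at every state, so its value is immaterial.
  forEach-trace (x ∷ xs) eq s = cong₂ _++_ (eq x s) (forEach-trace xs eq _)

  sources : ℕ → Fin n → List (Fin m)
  sources k w = filter (λ t → sourceBelowEnd? (shift k t) w) T[ k ]

  lowTerms : Fin n → List (Fin m)
  lowTerms w = filter (λ t → toℕ t / W ≤? toℕ w) Ts

  feedbackWordEvents : ℕ → Fin n → List Event
  feedbackWordEvents k w = traverse k w ∷ concatMap (λ t → [ feedbackShift k t w ]) (sources k w)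

  lowWordEvents : Fin n → List Event
  lowWordEvents w = assemble w ∷ concatMap (λ t → [ lowShift t w ]) (lowTerms w)

  -- `concatMap` is used even for singletons, so that `forEach-trace` and `mapMaybe-concatMap` apply
  -- at every level.
  extractEvents feedbackEvents lowEvents : List Event
  extractEvents  = concatMap (λ w → [ extract w ]) (allFin n)
  feedbackEvents = concatMap (λ k → concatMap (feedbackWordEvents k) (range k)) (upTo r)
  lowEvents      = concatMap lowWordEvents (allFin n)

  trace≡ : ∀ A → trace A ≡ extractEvents ++ feedbackEvents ++ lowEvents
  trace≡ A = cong₂ _++_ (forEach-trace (allFin n) (λ _ _ → refl) _)
    (cong₂ _++_
      (forEach-trace (upTo r) (λ k → forEach-trace (range k) λ w _ →
        cong (traverse k w ∷_) (forEach-trace (sources k w) (λ _ _ → refl) _)) _)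
      (forEach-trace (allFin n) (λ w _ →
        cong (assemble w ∷_) (forEach-trace (lowTerms w) (λ _ _ → refl) _)) _))

  mapMaybe-trace : {K : Set} (p : Event → Maybe K) {xs ys zs : List K} (A : Vector Bool (m + m)) →
                   mapMaybe p extractEvents ≡ xs → mapMaybe p feedbackEvents ≡ ys →
                   mapMaybe p lowEvents ≡ zs → mapMaybe p (trace A) ≡ xs ++ ys ++ zs
  mapMaybe-trace p A extract≡ feedback≡ low≡ =
    trans (cong (mapMaybe p) (trace≡ A))
    (trans (mapMaybe-++ p extractEvents _)
    (cong₂ _++_ extract≡ (trans (mapMaybe-++ p feedbackEvents lowEvents) (cong₂ _++_ feedback≡ low≡))))

  -- Low shifts are emitted by word; regrouped by term, `t` reaches the words from `toℕ t / W` on.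
  ∑-lowTerms : (∑[ w ∈ allFin n ] length (lowTerms w)) ≡ BV
  ∑-lowTerms = trans (count-swap (λ w t → toℕ t / W ≤? toℕ w) (allFin n) Ts)
    (∑-cong Ts λ {t} _ → count-≥ n (λ w → toℕ t / W ≤? toℕ w) (λ _ → id) (λ _ → id))

  extractions-trace : ∀ A → extractions (trace A) ≡ allFin n
  extractions-trace A = trans
    (mapMaybe-trace _ A
      (trans (mapMaybe-concatMap _ (allFin n) (λ _ → refl)) (concatMap-pure (allFin n)))
      (mapMaybe-concatMap-[] _ (upTo r) λ k → mapMaybe-concatMap-[] _ (range k) λ w →
        mapMaybe-concatMap-[] _ (sources k w) λ _ → refl)
      (mapMaybe-concatMap-[] _ (allFin n) λ w → mapMaybe-concatMap-[] _ (lowTerms w) λ _ → refl))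
    (++-identityʳ (allFin n))

  assemblies-trace : ∀ A → assemblies (trace A) ≡ allFin n
  assemblies-trace A = mapMaybe-trace _ A
    (mapMaybe-concatMap-[] _ (allFin n) λ _ → refl)
    (mapMaybe-concatMap-[] _ (upTo r) λ k → mapMaybe-concatMap-[] _ (range k) λ w →
      mapMaybe-concatMap-[] _ (sources k w) λ _ → refl)
    (trans (mapMaybe-concatMap _ (allFin n) λ w →
             cong (w ∷_) (mapMaybe-concatMap-[] _ (lowTerms w) λ _ → refl))
           (concatMap-pure (allFin n)))

  lowShifts-trace : ∀ A → length (lowShifts (trace A)) ≡ BV
  lowShifts-trace A = trans
    (cong length (mapMaybe-trace _ A
      (mapMaybe-concatMap-[] _ (allFin n) λ _ → refl)
      (mapMaybe-concatMap-[] _ (upTo r) λ k → mapMaybe-concatMap-[] _ (range k) λ w →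
        mapMaybe-concatMap-[] _ (sources k w) λ _ → refl)
      (mapMaybe-concatMap _ (allFin n) λ w → mapMaybe-concatMap _ (lowTerms w) λ t → refl)))
    (trans (length-concatMap _ (allFin n))
    (trans (∑-cong (allFin n) λ {w} _ → length-concatMap-[ lowTerms w ])
           ∑-lowTerms))

  traversals-trace : ∀ A k → traversals k (trace A) ≡
    concatMap (λ j → if does (j ≟ k) then range j else []) (upTo r)
  traversals-trace A k = trans
    (mapMaybe-trace _ A
      (mapMaybe-concatMap-[] _ (allFin n) λ _ → refl)
      (mapMaybe-concatMap _ (upTo r) stageTraversals)
      (mapMaybe-concatMap-[] _ (allFin n) λ w → mapMaybe-concatMap-[] _ (lowTerms w) λ _ → refl))
    (++-identityʳ _)
    where
    stageTraversals : ∀ j → traversals k (concatMap (feedbackWordEvents j) (range j)) ≡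
                            (if does (j ≟ k) then range j else [])
    -- The equation is kept because `traversals k` repeats the test `j ≟ k` at each `traverse`
    -- event, where it is rewritten again.
    stageTraversals j with does (j ≟ k) in eq
    ... | true  = trans (mapMaybe-concatMap _ (range j) wordTraversals) (concatMap-pure (range j))
      where
      wordTraversals : ∀ w → traversals k (feedbackWordEvents j w) ≡ [ w ]
      wordTraversals w rewrite eq = cong (w ∷_) (mapMaybe-concatMap-[] _ (sources j w) λ _ → refl)
    ... | false = mapMaybe-concatMap-[] _ (range j) wordTraversals
      where
      wordTraversals : ∀ w → traversals k (feedbackWordEvents j w) ≡ []
      wordTraversals w rewrite eq = mapMaybe-concatMap-[] _ (sources j w) λ _ → refl

  module _ (Δmin<m : Δmin < m) where

    -- The regrouping runs over `range k` only, whence the minimum with `a k`.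
    ∑-sources : ∀ {k} → k < r → (∑[ w ∈ range k ] length (sources k w)) ≡
                                (∑[ t ∈ T[ k ] ] (a k ⊓ (n ∸ shift k t / W)))
    ∑-sources {k} k<r = trans (count-swap (λ w t → sourceBelowEnd? (shift k t) w) (range k) T[ k ])
      (∑-cong T[ k ] λ {t} _ → count-sourceBelowEnd Δmin<m k<r (shift k t))

    feedbackShifts-trace : ∀ A → length (feedbackShifts (trace A)) ≡ Bfbloop
    feedbackShifts-trace A = trans
      (cong length (trans
        (mapMaybe-trace _ A
          (mapMaybe-concatMap-[] _ (allFin n) λ _ → refl)
          (mapMaybe-concatMap _ (upTo r) λ k → mapMaybe-concatMap _ (range k) λ w →
            mapMaybe-concatMap _ (sources k w) λ _ → refl)
          (mapMaybe-concatMap-[] _ (allFin n) λ w → mapMaybe-concatMap-[] _ (lowTerms w) λ _ → refl))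
        (++-identityʳ _)))
      (trans (length-concatMap _ (upTo r))
      (∑-cong (upTo r) λ {k} k∈ → trans (length-concatMap _ (range k))
        (trans (∑-cong (range k) λ {w} _ → length-concatMap-[ sources k w ])
               (∑-sources (∈-upTo⁻ k∈)))))

    length-traversals : ∀ A k → k < r → length (traversals k (trace A)) ≡ a k
    length-traversals A k k<r = begin
      length (traversals k (trace A))
        ≡⟨ cong length (traversals-trace A k) ⟩
      length (concatMap stage-k (upTo r))
        ≡⟨ length-concatMap stage-k (upTo r) ⟩
      ∑ (upTo r) (length ∘ stage-k)
        ≡⟨ ∑-single (length ∘ stage-k) (upTo⁺ r) (∈-upTo⁺ k<r) stage-k-other ⟩
      length (stage-k k)
        ≡⟨ cong (λ b → length (if b then range k else [])) (dec-true (k ≟ k) refl) ⟩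
      length (range k)
        ≡⟨ length-range Δmin<m k<r ⟩
      a k ∎
      where
      open ≡-Reasoning
      stage-k : ℕ → List (Fin n)
      stage-k j = if does (j ≟ k) then range j else []
      stage-k-other : ∀ {j} → j ≢ k → length (stage-k j) ≡ 0
      stage-k-other {j} j≢k =
        cong (λ b → length (if b then range j else [])) (dec-false (j ≟ k) j≢k)

    length-trace : ∀ A → length (trace A) ≡ n + (∑[ k ∈ upTo r ] a k) + n + (Bfbloop + BV)
    length-trace A = begin
      length (trace A)
        ≡⟨ cong length (trace≡ A) ⟩
      length (extractEvents ++ feedbackEvents ++ lowEvents)
        ≡⟨ trans (length-++ extractEvents) (cong (length extractEvents +_) (length-++ feedbackEvents)) ⟩
      length extractEvents + (length feedbackEvents + length lowEvents)
        ≡⟨ cong₂ _+_ lengthExtract (cong₂ _+_ lengthFeedback lengthLow) ⟩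
      n + ((∑a + Bfbloop) + (n + BV))
        ≡⟨ cong (n +_) (interchange ∑a Bfbloop n BV) ⟩
      n + ((∑a + n) + (Bfbloop + BV))
        ≡⟨ +-assoc n (∑a + n) (Bfbloop + BV) ⟨
      n + (∑a + n) + (Bfbloop + BV)
        ≡⟨ cong (_+ (Bfbloop + BV)) (+-assoc n ∑a n) ⟨
      n + ∑a + n + (Bfbloop + BV) ∎
      where
      open ≡-Reasoning
      ∑a : ℕ
      ∑a = ∑[ k ∈ upTo r ] a k

      lengthExtract : length extractEvents ≡ n
      lengthExtract = trans length-concatMap-[ allFin n ] (length-tabulate {n = n} id)

      lengthStage : ∀ {k} → k < r → length (concatMap (feedbackWordEvents k) (range k)) ≡
                    a k + (∑[ t ∈ T[ k ] ] (a k ⊓ (n ∸ shift k t / W)))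
      lengthStage {k} k<r = trans (length-concatMap _ (range k))
        -- `suc` is the `traverse` event heading the shifts of each word; over the range these add
        -- up to `a k`.
        (trans (∑-cong (range k) λ {w} _ → cong suc length-concatMap-[ sources k w ])
        (trans (∑-distrib-+ (range k) (const 1) (length ∘ sources k))
        (cong₂ _+_ (trans (∑-one (range k)) (length-range Δmin<m k<r)) (∑-sources k<r))))

      lengthFeedback : length feedbackEvents ≡ ∑a + Bfbloop
      lengthFeedback = trans (length-concatMap _ (upTo r))
        (trans (∑-cong (upTo r) λ k∈ → lengthStage (∈-upTo⁻ k∈)) (∑-distrib-+ (upTo r) a _))

      lengthLow : length lowEvents ≡ n + BV
      lengthLow = trans (length-concatMap _ (allFin n))
        (trans (∑-cong (allFin n) λ {w} _ → cong suc length-concatMap-[ lowTerms w ])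
        (trans (∑-distrib-+ (allFin n) (const 1) (length ∘ lowTerms))
        (cong₂ _+_ (trans (∑-one (allFin n)) (length-tabulate {n = n} id)) ∑-lowTerms)))

proposition5p3 : ∀ (m W : ℕ) .{{_ : NonZero m}} .{{_ : NonZero W}} (T : Subset m) →
    let open Reduction m W T in
    usefulSupport ≡ B̂fb ×
    lowTouched ≡ BV ×
    (U≢0 →
    loopContributions ≡ Bfbloop ×
    B̂fb ≤ Bfbloop ×
    Bfbloop ≤ B̂fb + Sfb ×
    (∑[ k ∈ upTo r ] a k) ≤ Bfbloop ×
    (∀ (A : Vector Bool (m + m)) →
    extractions (trace A) ≡ allFin n ×
    (∀ k → k < r → length (traversals k (trace A)) ≡ a k) ×
    assemblies (trace A) ≡ allFin n ×
    length (feedbackShifts (trace A)) ≡ Bfbloop ×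
    length (lowShifts (trace A)) ≡ BV ×
    length (trace A) ≡ n + (∑[ k ∈ upTo r ] a k) + n + (Bfbloop + BV)))
proposition5p3 m W T =
  usefulSupport≡B̂fb m W T , lowTouched≡BV m W T , λ U≢0 →
    -- `U≢0` enters as `Δmin < m`, which puts the least shift into every stage below `r`.
    let Δmin<m = U≢0⇒Δmin<m m W T U≢0 in
    loopContributions≡Bfbloop m W T Δmin<m , B̂fb≤Bfbloop m W T , Bfbloop≤B̂fb+Sfb m W T ,
    ∑a≤Bfbloop m W T Δmin<m , λ A →
      extractions-trace m W T A , length-traversals m W T Δmin<m A , assemblies-trace m W T A ,
      feedbackShifts-trace m W T Δmin<m A , lowShifts-trace m W T A , length-trace m W T Δmin<m A
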